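{- Let $U$ be a nonempty finite set and let $\mathcal{I}$ be a semi-interval system on $U$ such that $\mathcal{D}(U,\mathcal{I})$ is a Boolean lattice. Then there is a Boolean sublattice of $\mathrm{Part}(U)$ that contains $\mathcal{D}(U,\mathcal{I})$ and has the largest size among all Boolean sublattices of $\mathrm{Part}(U)$.
   Context: $\mathrm{Part}(U)$ is the lattice of all partitions of $U$ ordered by refinement. A Boolean sublattice is a sublattice (closed under meet and join of $\mathrm{Part}(U)$) that is itself a Boolean lattice. A closure system $(U,\mathcal{Q})$ is a family $\mathcal{Q}\subseteq\wp(U)$ containing $U$ and closed under arbitrary intersections. A semi-interval system is a closure system $(U,\mathcal{I})$ satisfying: (I$_0$) $\emptyset\in\mathcal{I}$ and $\{x\}\in\mathcal{I}$ for all $x\in U$; (I$_1$) if $A,B\in\mathcal{I}$ and $A\cap B\neq\emptyset$, then $A\cup B\in\mathcal{I}$. $\mathcal{D}(U,\mathcal{I})$ is the set of all partitions of $U$ all of whose blocks belong to $\mathcal{I}$, ordered by refinement. -}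

module Defs where

open import Level using (Level; 0ℓ; _⊔_) renaming (suc to lsuc)
open import Data.Bool.Base using (Bool; T)
open import Data.Fin.Base using (Fin)
open import Data.Fin.Subset using (Subset; _∈_; _⊆_; _∩_; _∪_; ⊤; ⊥; ⁅_⁆; ⋂; Nonempty)
open import Data.Fin.Subset.Properties using (⊆-antisym; x∈p∩q⁺)
open import Data.List.Base using (List)
open import Data.List.Relation.Unary.All using (All)
open import Data.Nat.Base using (ℕ; _≤_)
open import Data.Product.Base using (_×_; _,_; proj₁; ∃-syntax)
open import Data.Unit.Base using (tt)
open import Function.Bundles using (Bijection)
open import Relation.Binary.Bundles using (Poset)
open import Relation.Binary.Definitions using (_Respects_)
open import Relation.Binary.Lattice.Structures using (IsBooleanAlgebra)
open import Relation.Binary.PropositionalEquality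
  using (_≡_; _≗_; refl; sym; trans; subst)
import Relation.Binary.Construct.On as On
import Relation.Binary.PropositionalEquality.Properties as ≡
open import Relation.Unary using (Pred)

------------------------------------------------------------------------
-- Order theory

record IsBooleanLattice {c ℓ₁ ℓ₂ : Level} (P : Poset c ℓ₁ ℓ₂) : Set (c ⊔ ℓ₁ ⊔ ℓ₂) where
  open Poset P using (Carrier; _≈_) renaming (_≤_ to _⊑_)
  field
    join meet  : Carrier → Carrier → Carrier
    complement : Carrier → Carrier
    top bottom : Carrier
    isBooleanAlgebra : IsBooleanAlgebra _≈_ _⊑_ join meet complement top bottom

module _ {c ℓ₁ ℓ₂ : Level} (P : Poset c ℓ₁ ℓ₂) where
  private module P = Poset P

  IsMeet : P.Carrier → P.Carrier → P.Carrier → Set (c ⊔ ℓ₂)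
  IsMeet x y m = m P.≤ x × m P.≤ y × (∀ z → z P.≤ x → z P.≤ y → z P.≤ m)

  IsJoin : P.Carrier → P.Carrier → P.Carrier → Set (c ⊔ ℓ₂)
  IsJoin x y j = x P.≤ j × y P.≤ j × (∀ z → x P.≤ z → y P.≤ z → j P.≤ z)

  module _ {ℓ : Level} (B : Pred P.Carrier ℓ) where

    subPoset : Poset (c ⊔ ℓ) ℓ₁ ℓ₂
    subPoset = On.poset P (proj₁ {B = B})

    -- The meets and joins are those of the ambient P, not merely those of
    -- the induced order.  The bounds of P need not belong to B.
    record IsSublattice : Set (c ⊔ ℓ₁ ⊔ ℓ₂ ⊔ ℓ) where
      field
        respects    : B Respects P._≈_
        meet-closed : ∀ {x y} → B x → B y → ∃[ m ] (B m × IsMeet x y m)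
        join-closed : ∀ {x y} → B x → B y → ∃[ j ] (B j × IsJoin x y j)

    record IsBooleanSublattice : Set (c ⊔ ℓ₁ ⊔ ℓ₂ ⊔ ℓ) where
      field
        isSublattice     : IsSublattice
        isBooleanLattice : IsBooleanLattice subPoset

    -- Elements are counted up to the equality of P.
    HasSize : ℕ → Set (c ⊔ ℓ₁ ⊔ ℓ)
    HasSize k = Bijection (≡.setoid (Fin k)) (Poset.Eq.setoid subPoset)

  -- Every ≈-respecting decidable subset of a finite poset has a size, so the
  -- HasSize hypothesis on B′ excludes no competitor when P is finite.
  HasLargestSizeAmongBooleanSublattices :
    {ℓ : Level} → Pred P.Carrier ℓ → Set (c ⊔ ℓ₁ ⊔ ℓ₂ ⊔ lsuc ℓ)
  HasLargestSizeAmongBooleanSublattices {ℓ} B =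
    ∃[ k ] (HasSize B k ×
            ((B′ : Pred P.Carrier ℓ) (k′ : ℕ) →
             IsBooleanSublattice B′ → HasSize B′ k′ → k′ ≤ k))

------------------------------------------------------------------------
-- Families of subsets of U = Fin n, as characteristic functions

Family : ℕ → Set
Family n = Subset n → Bool

infix 4 _∈ᶠ_

_∈ᶠ_ : ∀ {n} → Subset n → Family n → Set
A ∈ᶠ F = T (F A)

-- Every subfamily of a family on a finite set can be listed, so closure under
-- intersections of lists is closure under arbitrary intersections.
record IsClosureSystem {n : ℕ} (Q : Family n) : Set where
  field
    full-∈   : ⊤ ∈ᶠ Q
    ⋂-closed : (As : List (Subset n)) → All (_∈ᶠ Q) As → ⋂ As ∈ᶠ Q

record IsSemiIntervalSystem {n : ℕ} (I : Family n) : Set where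
  field
    isClosureSystem : IsClosureSystem I
    empty-∈         : ⊥ ∈ᶠ I
    singleton-∈     : ∀ x → ⁅ x ⁆ ∈ᶠ I
    ∪-closed        : ∀ {A B} → A ∈ᶠ I → B ∈ᶠ I → Nonempty (A ∩ B) → A ∪ B ∈ᶠ I

------------------------------------------------------------------------
-- Partitions

record Partition (n : ℕ) : Set where
  field
    blocks   : Family n
    nonempty : ∀ {A} → A ∈ᶠ blocks → Nonempty A
    disjoint : ∀ {A B} → A ∈ᶠ blocks → B ∈ᶠ blocks → Nonempty (A ∩ B) → A ≡ B
    covers   : ∀ x → ∃[ A ] (A ∈ᶠ blocks × x ∈ A)

open Partition

infix 4 _≈ₚ_ _≤ₚ_

_≈ₚ_ : ∀ {n} → Partition n → Partition n → Set
π ≈ₚ σ = blocks π ≗ blocks σ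

_≤ₚ_ : ∀ {n} → Partition n → Partition n → Set
π ≤ₚ σ = ∀ A → A ∈ᶠ blocks π → ∃[ B ] (B ∈ᶠ blocks σ × A ⊆ B)

private
  T-ext : ∀ {a b} → (T a → T b) → (T b → T a) → a ≡ b
  T-ext {Bool.true}  {Bool.true}  _ _ = refl
  T-ext {Bool.false} {Bool.false} _ _ = refl
  T-ext {Bool.true}  {Bool.false} f _ with () ← f tt
  T-ext {Bool.false} {Bool.true}  _ g with () ← g tt

  ≤ₚ-blocks : ∀ {n} {π σ : Partition n} → π ≤ₚ σ → σ ≤ₚ π →
              ∀ {A} → A ∈ᶠ blocks π → A ∈ᶠ blocks σ
  ≤ₚ-blocks {π = π} {σ} π≤σ σ≤π {A} A∈π
    with B , B∈σ , A⊆B ← π≤σ A A∈π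
    with C , C∈π , B⊆C ← σ≤π B B∈σ
    with x , x∈A ← nonempty π A∈π
    with refl ← disjoint π A∈π C∈π (x , x∈p∩q⁺ (x∈A , B⊆C (A⊆B x∈A)))
    = subst (_∈ᶠ blocks σ) (⊆-antisym B⊆C A⊆B) B∈σ

Part : ℕ → Poset 0ℓ 0ℓ 0ℓ
Part n = record
  { Carrier = Partition n
  ; _≈_ = _≈ₚ_
  ; _≤_ = _≤ₚ_
  ; isPartialOrder = record
    { isPreorder = record
      { isEquivalence = record
        { refl  = λ _ → refl
        ; sym   = λ e A → sym (e A)
        ; trans = λ e f A → trans (e A) (f A)
        }
      ; reflexive = λ e A A∈π → A , subst T (e A) A∈π , λ x∈A → x∈A
      ; trans = λ π≤σ σ≤τ A A∈π →
          let B , B∈σ , A⊆B = π≤σ A A∈π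
              C , C∈τ , B⊆C = σ≤τ B B∈σ
          in C , C∈τ , λ x∈A → B⊆C (A⊆B x∈A)
      }
    ; antisym = λ {π} {σ} π≤σ σ≤π A →
        T-ext (≤ₚ-blocks {π = π} {σ} π≤σ σ≤π) (≤ₚ-blocks {π = σ} {π} σ≤π π≤σ)
    }
  }

𝓓 : ∀ {n} → Family n → Pred (Partition n) 0ℓ
𝓓 I π = ∀ A → A ∈ᶠ blocks π → A ∈ᶠ I

{-# OPTIONS --safe #-}
-- A distributive sublattice of Part(U) has at most 2^(|U|-1) elements, because the rank
-- |U| - #blocks is strictly monotone and an interval [a, b] embeds into [a, c] × [c, b].
-- A spanning tree of U attains the bound: its edge sets, read as partitions into connected
-- components, form a Boolean sublattice.  It contains 𝓓 as soon as every set of I is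
-- connected in the tree.  Such a tree is grown from one vertex, keeping the set B of reached
-- vertices in I: complements in 𝓓 give a set E of I that leaves B and meets it in a single
-- point b, and for E of least size the new vertices can all be joined to b, since by
-- distributivity every set of I reaching from E into B contains b.

module Submission where

open import Defs
open import Level using (0ℓ)
open import Data.Bool.Base using (if_then_else_)
import Data.Bool.Properties as Bool
import Data.Empty as Empty
open import Data.Fin.Base
  using (Fin; zero; suc; combine; finToFun; funToFin)
  renaming (_<_ to _<ᶠ_)
open import Data.Fin.Induction using () renaming (<-wellFounded to <ᶠ-wellFounded)
open import Data.Fin.Properties
  using (any?; finToFun-funToFin; funToFin-finToFin; 2↔Bool; all?; combine-injective;
         injective⇒≤)
  renaming (_≟_ to _≟ᶠ_; _<?_ to _<ᶠ?_; <-cmp to <ᶠ-cmp)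
open import Data.Fin.Subset
  using (Subset; _∈_; _∉_; _∩_; _∪_; ⊤; ⁅_⁆; ∣_∣; ⊥; ∁)
  renaming (_⊆_ to _⊆ˢ_)
open import Data.Fin.Subset.Properties
  using (_∈?_; ⊆-antisym; ∩-identityʳ; x∈p∩q⁺; x∈p∩q⁻; x∈p∪q⁺; x∈p∪q⁻; q⊆p∪q; x∈⁅x⁆;
         x∈⁅y⁆⇒x≡y; ∈⊤; p⊆p∪q; anySubset?; p⊂q⇒∣p∣<∣q∣; ∣p∣≤n; ∣p∣≡n⇒p≡⊤; p∩q⊆p; p∩q⊆q;
         ⊆-min; x∉p⇒x∈∁p; x∈∁p⇒x∉p; p⊆q⇒∣p∣≤∣q∣; ∣⊤∣≡n)
open import Data.List.Base using (List; []; _∷_; allFin)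
open import Data.List.Membership.Propositional using () renaming (_∈_ to _∈ˡ_)
open import Data.List.Membership.Propositional.Properties using (∈-allFin)
open import Data.List.Relation.Unary.All using ([]; _∷_)
open import Data.List.Relation.Unary.Any using (here; there)
open import Data.Maybe.Base using (Maybe; just; nothing)
import Data.Maybe.Properties as Maybe
open import Data.Nat.Base
  using (ℕ; zero; suc; _+_; _≤_; _<_; s≤s⁻¹; _^_; _∸_; _*_; NonZero)
open import Data.Nat.Induction using (<-wellFounded)
open import Data.Nat.Properties
  using (≤-trans; ≤-reflexive; ≤-antisym; +-suc; +-monoʳ-≤; ≮⇒≥; _<?_; <-≤-trans; <⇒≱;
         <⇒≤; n<1+n; m≤m+n; <-irrefl; <-trans; <-asym; *-mono-≤; ^-monoʳ-≤;
         ^-distribˡ-+-*; m^n>0; ∸-monoˡ-<; ∸-monoʳ-<; m<n⇒0<n∸m; m∸n≤m; +-∸-assoc;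
         +-comm; m∸n+n≡m)
open import Data.Product.Base using (_×_; _,_; proj₁; proj₂; ∃-syntax)
open import Data.Sum.Base using (_⊎_; inj₁; inj₂; [_,_]′)
open import Data.Vec.Base using (tabulate; lookup)
open import Data.Vec.Properties
  using (lookup∘tabulate; lookup⇒[]=; []=⇒lookup; ≡-dec; tabulate∘lookup; tabulate-cong)
open import Function.Base using (id; _∘_)
open import Function.Bundles using (Inverse; Bijection)
open import Induction.WellFounded using (Acc; acc)
open import Relation.Binary.Bundles using (Poset)
open import Relation.Binary.Definitions
  using (DecidableEquality; tri<; tri≈; tri>)
  renaming (Decidable to Decidable₂)
open import Relation.Binary.Lattice.Bundles using (BooleanAlgebra)
import Relation.Binary.Lattice.Properties.HeytingAlgebra as HeytingProperties
open import Relation.Binary.PropositionalEquality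
  using (_≡_; _≢_; refl; sym; trans; cong; subst; _≗_; cong₂)
open import Relation.Nullary.Decidable
  using (Dec; yes; no; does; isYes; fromWitness; toWitness; dec-true; toSum; T?; ¬?;
         _×-dec_; decidable-stable; map′; _→-dec_)
open import Relation.Nullary.Negation using (contradiction; ¬_)
open import Relation.Unary using (Pred; Decidable; _⊆_)

open Partition

private variable
  n : ℕ

_≟ˢ_ : DecidableEquality (Subset n)
_≟ˢ_ = ≡-dec Bool._≟_

-- Partitions as equivalence relations

block : Partition n → Fin n → Subset n
block π x = proj₁ (covers π x)

infix 4 _∼[_]_

_∼[_]_ : Fin n → Partition n → Fin n → Set
x ∼[ π ] y = block π x ≡ block π y

module _ (π : Partition n) where

  block∈blocks : ∀ x → block π x ∈ᶠ blocks π
  block∈blocks x = proj₁ (proj₂ (covers π x))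

  x∈block : ∀ x → x ∈ block π x
  x∈block x = proj₂ (proj₂ (covers π x))

  block-unique : ∀ {A x} → A ∈ᶠ blocks π → x ∈ A → A ≡ block π x
  block-unique {x = x} A∈π x∈A =
    disjoint π A∈π (block∈blocks x) (x , x∈p∩q⁺ (x∈A , x∈block x))

  ∈block⇒∼ : ∀ {x y} → y ∈ block π x → x ∼[ π ] y
  ∈block⇒∼ = block-unique (block∈blocks _)

  ∼⇒∈block : ∀ {x y} → x ∼[ π ] y → y ∈ block π x
  ∼⇒∈block {y = y} x∼y = subst (y ∈_) (sym x∼y) (x∈block y)

≤ₚ⇒∼ : ∀ (π σ : Partition n) → π ≤ₚ σ → ∀ {x y} → x ∼[ π ] y → x ∼[ σ ] y
≤ₚ⇒∼ π σ π≤σ {x} x∼y with B , B∈σ , ⊆B ← π≤σ (block π x) (block∈blocks π x) =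
  trans (sym (block-unique σ B∈σ (⊆B (x∈block π x))))
        (block-unique σ B∈σ (⊆B (∼⇒∈block π x∼y)))

∼⇒≤ₚ : ∀ (π σ : Partition n) → (∀ {x y} → x ∼[ π ] y → x ∼[ σ ] y) → π ≤ₚ σ
∼⇒≤ₚ π σ ∼⇒∼ A A∈π with x , x∈A ← nonempty π A∈π =
  block σ x , block∈blocks σ x , λ y∈A →
    ∼⇒∈block σ (∼⇒∼ (trans (sym (block-unique π A∈π x∈A)) (block-unique π A∈π y∈A)))

-- Decidable subsets, and partitions into fibres

module _ {P : Pred (Fin n) 0ℓ} (P? : Decidable P) where

  subset : Subset n
  subset = tabulate λ x → does (P? x)

  ∈-subset⁺ : ∀ {x} → P x → x ∈ subset
  ∈-subset⁺ {x} px = lookup⇒[]= x _ (trans (lookup∘tabulate _ x) (dec-true (P? x) px))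

  ∈-subset⁻ : ∀ {x} → x ∈ subset → P x
  ∈-subset⁻ {x} x∈
    with P? x | trans (sym (lookup∘tabulate (λ y → does (P? y)) x)) ([]=⇒lookup x∈)
  ... | yes px | _ = px
  ... | no  _  | ()

module _ {X : Set} (_≟_ : DecidableEquality X) (f : Fin n → X) where

  fibre : Fin n → Subset n
  fibre x = subset λ y → f x ≟ f y

  ∈-fibre⁺ : ∀ {x y} → f x ≡ f y → y ∈ fibre x
  ∈-fibre⁺ {x} = ∈-subset⁺ λ y → f x ≟ f y

  ∈-fibre⁻ : ∀ {x y} → y ∈ fibre x → f x ≡ f y
  ∈-fibre⁻ {x} = ∈-subset⁻ λ y → f x ≟ f y

  fibre-cong : ∀ {x y} → f x ≡ f y → fibre x ≡ fibre y
  -- `fibre x` mentions `x` only through `f x`, so equal labels give literally equal subsets.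
  fibre-cong fx≡fy = cong (λ l → subset λ z → l ≟ f z) fx≡fy

  opaque
    kernel : Partition n
    kernel .blocks A = isYes (any? λ x → A ≟ˢ fibre x)
    kernel .nonempty A∈ with x , refl ← toWitness A∈ = x , ∈-fibre⁺ refl
    kernel .disjoint A∈ B∈ (z , z∈)
      with x , refl ← toWitness A∈ | y , refl ← toWitness B∈
      with z∈x , z∈y ← x∈p∩q⁻ (fibre x) (fibre y) z∈ =
      fibre-cong (trans (∈-fibre⁻ z∈x) (sym (∈-fibre⁻ z∈y)))
    kernel .covers x = fibre x , fromWitness (x , refl) , ∈-fibre⁺ refl

    ∼-kernel⁺ : ∀ {x y} → f x ≡ f y → x ∼[ kernel ] y
    ∼-kernel⁺ = fibre-cong

    ∼-kernel⁻ : ∀ {x y} → x ∼[ kernel ] y → f x ≡ f y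
    ∼-kernel⁻ x∼y = ∈-fibre⁻ (∼⇒∈block kernel x∼y)

    𝓓-kernel : ∀ {I : Family n} → (∀ x → fibre x ∈ᶠ I) → 𝓓 I kernel
    𝓓-kernel fibre∈I A A∈ with x , refl ← toWitness A∈ = fibre∈I x

discrete : Partition n
discrete = kernel _≟ᶠ_ id

Saturated : Partition n → Pred (Subset n) 0ℓ
Saturated π A = ∀ {x y} → x ∼[ π ] y → x ∈ A → y ∈ A

-- Merging a set of points into one block

module Collapse (A : Subset n) (π : Partition n) where

  -- The points of `A` share the fresh label `nothing`, the others keep their block. For `A`
  -- saturated under `π`, the kernel is the join of `π` and `single A`.
  label : Fin n → Maybe (Subset n)
  label x = if does (x ∈? A) then nothing else just (block π x)

  label-∈ : ∀ {x} → x ∈ A → label x ≡ nothing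
  label-∈ {x} x∈A with x ∈? A
  ... | yes _   = refl
  ... | no  x∉A = contradiction x∈A x∉A

  _≟ˡ_ : DecidableEquality (Maybe (Subset n))
  _≟ˡ_ = Maybe.≡-dec _≟ˢ_

  collapse : Partition n
  collapse = kernel _≟ˡ_ label

  ∼-inside : ∀ {x y} → x ∈ A → y ∈ A → x ∼[ collapse ] y
  ∼-inside x∈A y∈A = ∼-kernel⁺ _≟ˡ_ label (trans (label-∈ x∈A) (sym (label-∈ y∈A)))

  label-cases : ∀ {x y} → label x ≡ label y → (x ∈ A × y ∈ A) ⊎ x ∼[ π ] y
  label-cases {x} {y} eq with x ∈? A | y ∈? A
  ... | yes x∈A | yes y∈A = inj₁ (x∈A , y∈A)
  ... | no  _   | no  _   = inj₂ (Maybe.just-injective eq)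

  ∼-collapse⁻ : ∀ {x y} → x ∼[ collapse ] y → (x ∈ A × y ∈ A) ⊎ x ∼[ π ] y
  ∼-collapse⁻ x∼y = label-cases (∼-kernel⁻ _≟ˡ_ label x∼y)

  module _ (saturated : Saturated π A) where

    label-∼ : ∀ {x y} → x ∼[ π ] y → label x ≡ label y
    label-∼ {x} {y} x∼y with x ∈? A | y ∈? A
    ... | yes _   | yes _   = refl
    ... | no  _   | no  _   = cong just x∼y
    ... | yes x∈A | no  y∉A = contradiction (saturated x∼y x∈A) y∉A
    ... | no  x∉A | yes y∈A = contradiction (saturated (sym x∼y) y∈A) x∉A

    ≤-collapse : π ≤ₚ collapse
    ≤-collapse = ∼⇒≤ₚ π collapse λ x∼y → ∼-kernel⁺ _≟ˡ_ label (label-∼ x∼y)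

    fibre-∈ : ∀ {x} → x ∈ A → fibre _≟ˡ_ label x ≡ A
    fibre-∈ x∈A = ⊆-antisym
      (λ y∈ → [ proj₂ , (λ x∼y → saturated x∼y x∈A) ]′ (label-cases (∈-fibre⁻ _≟ˡ_ label y∈)))
      (λ y∈A → ∈-fibre⁺ _≟ˡ_ label (trans (label-∈ x∈A) (sym (label-∈ y∈A))))

    fibre-∉ : ∀ {x} → x ∉ A → fibre _≟ˡ_ label x ≡ block π x
    fibre-∉ x∉A = ⊆-antisym
      (λ y∈ → [ (λ (x∈A , _) → contradiction x∈A x∉A) , ∼⇒∈block π ]′
                (label-cases (∈-fibre⁻ _≟ˡ_ label y∈)))
      (λ y∈ → ∈-fibre⁺ _≟ˡ_ label (label-∼ (∈block⇒∼ π y∈)))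

    𝓓-collapse : ∀ {I : Family n} → A ∈ᶠ I → 𝓓 I π → 𝓓 I collapse
    𝓓-collapse {I} A∈I π∈𝓓 = 𝓓-kernel _≟ˡ_ label fibre∈I where
      fibre∈I : ∀ x → fibre _≟ˡ_ label x ∈ᶠ I
      fibre∈I x =
        [ (λ x∈A → subst (_∈ᶠ I) (sym (fibre-∈ x∈A)) A∈I)
        , (λ x∉A → subst (_∈ᶠ I) (sym (fibre-∉ x∉A)) (π∈𝓓 _ (block∈blocks π x)))
        ]′ (toSum (x ∈? A))

open Collapse using (collapse)

-- In this form a set of `I` becomes an element of `𝓓 I`, so that the lattice laws can speak about
-- sets.
single : Subset n → Partition n
single A = collapse A discrete

single-∼⁺ : ∀ {A : Subset n} {x y} → x ∈ A → y ∈ A → x ∼[ single A ] y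
single-∼⁺ {A = A} = Collapse.∼-inside A discrete

single-∼⁻ : ∀ {A : Subset n} {x y} → x ∼[ single A ] y → (x ∈ A × y ∈ A) ⊎ x ≡ y
single-∼⁻ {A = A} x∼y with Collapse.∼-collapse⁻ A discrete x∼y
... | inj₁ both = inj₁ both
... | inj₂ x≈y  = inj₂ (∼-kernel⁻ _≟ᶠ_ id x≈y)

single-≤ : ∀ {A : Subset n} (π : Partition n) →
           (∀ {x y} → x ∈ A → y ∈ A → x ∼[ π ] y) → single A ≤ₚ π
single-≤ {A = A} π A∼ = ∼⇒≤ₚ (single A) π λ x∼y →
  [ (λ (x∈A , y∈A) → A∼ x∈A y∈A) , cong (block π) ]′ (single-∼⁻ x∼y)

-- Semi-interval systems: intersections and saturations

module SemiInterval {I : Family n} (isSemiInterval : IsSemiIntervalSystem I) where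
  open IsSemiIntervalSystem isSemiInterval public
  open IsClosureSystem isClosureSystem public

  ∩-closed : ∀ {A B} → A ∈ᶠ I → B ∈ᶠ I → A ∩ B ∈ᶠ I
  -- `⋂` ends in `⊤`, so the two-element list yields `A ∩ (B ∩ ⊤)`.
  ∩-closed {A} {B} A∈I B∈I = subst (λ C → A ∩ C ∈ᶠ I) (∩-identityʳ B)
    (⋂-closed (A ∷ B ∷ []) (A∈I ∷ B∈I ∷ []))

  discrete∈𝓓 : 𝓓 I discrete
  discrete∈𝓓 = 𝓓-kernel _≟ᶠ_ id λ x → subst (_∈ᶠ I) (⁅x⁆≡fibre x) (singleton-∈ x)
    where
    ⁅x⁆≡fibre : ∀ x → ⁅ x ⁆ ≡ fibre _≟ᶠ_ id x
    ⁅x⁆≡fibre x = ⊆-antisym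
      (λ y∈ → ∈-fibre⁺ _≟ᶠ_ id (sym (x∈⁅y⁆⇒x≡y x y∈)))
      (λ y∈ → subst (_∈ ⁅ x ⁆) (∈-fibre⁻ _≟ᶠ_ id y∈) (x∈⁅x⁆ x))

  single∈𝓓 : ∀ {A} → A ∈ᶠ I → 𝓓 I (single A)
  single∈𝓓 {A} A∈I = Collapse.𝓓-collapse A discrete
    (λ x∼y → subst (_∈ A) (∼-kernel⁻ _≟ᶠ_ id x∼y)) A∈I discrete∈𝓓

  module Saturation {A : Subset n} (A∈I : A ∈ᶠ I) {π : Partition n} (π∈𝓓 : 𝓓 I π) where

    -- Over all points this is the `π`-saturation of `A`. Blocks come one at a time because
    -- `∪-closed` is binary and needs an overlap: each new block meets what is already there in a
    -- point of `A`.
    adjoinBlocks : List (Fin n) → Subset n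
    adjoinBlocks []       = A
    adjoinBlocks (x ∷ xs) with x ∈? A
    ... | yes _ = block π x ∪ adjoinBlocks xs
    ... | no  _ = adjoinBlocks xs

    A⊆adjoinBlocks : ∀ xs → A ⊆ˢ adjoinBlocks xs
    A⊆adjoinBlocks []       y∈A = y∈A
    A⊆adjoinBlocks (x ∷ xs) y∈A with x ∈? A
    ... | yes _ = q⊆p∪q (block π x) _ (A⊆adjoinBlocks xs y∈A)
    ... | no  _ = A⊆adjoinBlocks xs y∈A

    adjoinBlocks∈I : ∀ xs → adjoinBlocks xs ∈ᶠ I
    adjoinBlocks∈I []       = A∈I
    adjoinBlocks∈I (x ∷ xs) with x ∈? A
    ... | yes x∈A = ∪-closed (π∈𝓓 _ (block∈blocks π x)) (adjoinBlocks∈I xs)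
                      (x , x∈p∩q⁺ (x∈block π x , A⊆adjoinBlocks xs x∈A))
    ... | no  _   = adjoinBlocks∈I xs

    adjoinBlocks⁻ : ∀ xs {y} → y ∈ adjoinBlocks xs → ∃[ a ] (a ∈ A × a ∼[ π ] y)
    adjoinBlocks⁻ []       {y} y∈ = y , y∈ , refl
    adjoinBlocks⁻ (x ∷ xs) {y} y∈ with x ∈? A
    ... | no  _   = adjoinBlocks⁻ xs y∈
    ... | yes x∈A with x∈p∪q⁻ (block π x) _ y∈
    ...   | inj₁ y∈x  = x , x∈A , ∈block⇒∼ π y∈x
    ...   | inj₂ y∈xs = adjoinBlocks⁻ xs y∈xs

    adjoinBlocks⁺ : ∀ {xs a y} → a ∈ˡ xs → a ∈ A → a ∼[ π ] y → y ∈ adjoinBlocks xs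
    adjoinBlocks⁺ {x ∷ xs} a∈xs a∈A a∼y with x ∈? A | a∈xs
    ... | yes _   | here refl = x∈p∪q⁺ (inj₁ (∼⇒∈block π a∼y))
    ... | yes _   | there a∈  = x∈p∪q⁺ (inj₂ (adjoinBlocks⁺ a∈ a∈A a∼y))
    ... | no  x∉A | here refl = contradiction a∈A x∉A
    ... | no  _   | there a∈  = adjoinBlocks⁺ a∈ a∈A a∼y

    saturation : Subset n
    saturation = adjoinBlocks (allFin n)

    saturation-saturated : Saturated π saturation
    saturation-saturated x∼y x∈ with a , a∈A , a∼x ← adjoinBlocks⁻ (allFin n) x∈ =
      adjoinBlocks⁺ (∈-allFin a) a∈A (trans a∼x x∼y)

-- Gates and attachment points, from complements and distributivity in `𝓓`

module BooleanSemiInterval {n : ℕ}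
  {I : Family n} (isSemiInterval : IsSemiIntervalSystem I)
  (boolean : IsBooleanLattice (subPoset (Part n) (𝓓 I))) where

  open SemiInterval isSemiInterval
  open IsBooleanLattice boolean using (isBooleanAlgebra)

  private
    𝔹 : BooleanAlgebra _ _ _
    𝔹 = record { isBooleanAlgebra = isBooleanAlgebra }
    module 𝔹 = BooleanAlgebra 𝔹
  open 𝔹 using (_∧_; _∨_) renaming (_≤_ to _⊑_)
  open HeytingProperties 𝔹.heytingAlgebra using (∧-distribˡ-∨-≤)

  singleᴰ : ∀ {A} → A ∈ᶠ I → 𝔹.Carrier
  singleᴰ {A} A∈I = single A , single∈𝓓 A∈I

  opaque
    -- The gates of A are the blocks of the complement of single A.
    gate : ∀ {A a} → A ∈ᶠ I → a ∈ A → ∀ b →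
           ∃[ G ] (G ∈ᶠ I × b ∈ G × (∃[ g ] (g ∈ G × g ∈ A))
                 × (∀ {u v} → u ∈ G → v ∈ G → u ∈ A → v ∈ A → u ≡ v))
    gate {A} {a} A∈I a∈A b =
      G , G∈I , x∈block σ b , meets , meets-once
      where
      α ¬α : 𝔹.Carrier
      α  = singleᴰ A∈I
      ¬α = 𝔹.¬ α
      σ : Partition n
      σ = proj₁ ¬α

      G : Subset n
      G = block σ b

      G∈I : G ∈ᶠ I
      G∈I = proj₂ ¬α G (block∈blocks σ b)

      -- Implication `x ⇨ y` is `¬ x ∨ y` here, so residuation gives both complement laws.
      ¬α∧α≤⊥ : ¬α ∧ α ⊑ 𝔹.⊥
      ¬α∧α≤⊥ = 𝔹.transpose-∧ (𝔹.x≤x∨y ¬α 𝔹.⊥)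

      ⊤≤¬α∨α : 𝔹.⊤ ⊑ ¬α ∨ α
      ⊤≤¬α∨α = 𝔹.transpose-⇨ (𝔹.x∧y≤y 𝔹.⊤ α)

      -- `single (G ∩ A)` belongs to `𝓓 I` and lies below both `¬α` and `α`, hence below the
      -- discrete partition.
      meets-once : ∀ {u v} → u ∈ G → v ∈ G → u ∈ A → v ∈ A → u ≡ v
      meets-once {u} {v} u∈G v∈G u∈A v∈A =
        ∼-kernel⁻ _≟ᶠ_ id (≤ₚ⇒∼ (single (G ∩ A)) discrete γ≤discrete
          (single-∼⁺ (x∈p∩q⁺ (u∈G , u∈A)) (x∈p∩q⁺ (v∈G , v∈A))))
        where
        γ : 𝔹.Carrier
        γ = singleᴰ (∩-closed G∈I A∈I)

        γ≤¬α : γ ⊑ ¬α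
        γ≤¬α = single-≤ σ λ x∈ y∈ → trans
          (sym (∈block⇒∼ σ (proj₁ (x∈p∩q⁻ G A x∈)))) (∈block⇒∼ σ (proj₁ (x∈p∩q⁻ G A y∈)))

        γ≤α : γ ⊑ α
        γ≤α = single-≤ (single A) λ x∈ y∈ →
          single-∼⁺ (proj₂ (x∈p∩q⁻ G A x∈)) (proj₂ (x∈p∩q⁻ G A y∈))

        γ≤discrete : γ ⊑ (discrete , discrete∈𝓓)
        γ≤discrete = 𝔹.trans {γ} {¬α ∧ α} {discrete , discrete∈𝓓} (𝔹.∧-greatest {γ} {¬α} {α} γ≤¬α γ≤α)
          (𝔹.trans {¬α ∧ α} {𝔹.⊥} {discrete , discrete∈𝓓} ¬α∧α≤⊥ (𝔹.minimum (discrete , discrete∈𝓓)))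

      open Saturation A∈I {σ} (proj₂ ¬α)

      -- `τ` merges all blocks of `σ` that meet `A`. It is an upper bound of `¬α` and `α` in `𝓓 I`,
      -- so it relates all points, and the block `G` of `b` must meet `A`.
      τ : 𝔹.Carrier
      τ = collapse saturation σ ,
          Collapse.𝓓-collapse saturation σ saturation-saturated
            (adjoinBlocks∈I (allFin n)) (proj₂ ¬α)

      full : 𝔹.Carrier
      full = singleᴰ full-∈

      full≤τ : full ⊑ τ
      full≤τ = 𝔹.trans {full} {𝔹.⊤} {τ} (𝔹.maximum full) (𝔹.trans {𝔹.⊤} {¬α ∨ α} {τ} ⊤≤¬α∨α
        (𝔹.∨-least {¬α} {α} {τ} (Collapse.≤-collapse saturation σ saturation-saturated)
          (single-≤ (proj₁ τ) λ x∈A y∈A → Collapse.∼-inside saturation σ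
            (A⊆adjoinBlocks (allFin n) x∈A) (A⊆adjoinBlocks (allFin n) y∈A))))

      meets : ∃[ g ] (g ∈ G × g ∈ A)
      meets = [ (λ (_ , b∈) → fromSaturation (adjoinBlocks⁻ (allFin n) b∈))
              , (λ a∼b → a , ∼⇒∈block σ (sym a∼b) , a∈A)
              ]′ (Collapse.∼-collapse⁻ saturation σ
                   (≤ₚ⇒∼ (single ⊤) (proj₁ τ) full≤τ (single-∼⁺ {x = a} {y = b} ∈⊤ ∈⊤)))
        where
        fromSaturation : ∃[ c ] (c ∈ A × c ∼[ σ ] b) → ∃[ g ] (g ∈ G × g ∈ A)
        fromSaturation (c , c∈A , c∼b) = c , ∼⇒∈block σ (sym c∼b) , c∈A

    -- Through `c`, the set `A ∪ B` lies in one class of `α ∨ β`, so `ε ⊑ α ∨ β`. As `E` meets `B`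
    -- at most in `b`, `ε ∧ β` is discrete, and distributivity leaves `ε ⊑ α`. Then `single A`
    -- relates the distinct points `x` and `b`, so both lie in `A`.
    attach : ∀ {A B E b c x} → A ∈ᶠ I → B ∈ᶠ I → E ∈ᶠ I →
             c ∈ A → c ∈ B → E ⊆ˢ A ∪ B →
             (∀ {u} → u ∈ E → u ∈ B → u ≡ b) → b ∈ E → x ∈ E → x ≢ b → b ∈ A
    attach {A} {B} {E} {b} {c} {x} A∈I B∈I E∈I c∈A c∈B E⊆A∪B E∩B b∈E x∈E x≢b =
      [ proj₂ , (λ x≡b → contradiction x≡b x≢b) ]′
        (single-∼⁻ {A = A} (≤ₚ⇒∼ (single E) (single A) ε≤α (single-∼⁺ x∈E b∈E)))
      where
      α β ε : 𝔹.Carrier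
      α = singleᴰ A∈I
      β = singleᴰ B∈I
      ε = singleᴰ E∈I

      j : Partition n
      j = proj₁ (α ∨ β)

      ∼c : ∀ {u} → u ∈ E → u ∼[ j ] c
      ∼c u∈E with x∈p∪q⁻ A B (E⊆A∪B u∈E)
      ... | inj₁ u∈A = ≤ₚ⇒∼ (single A) j (𝔹.x≤x∨y α β) (single-∼⁺ u∈A c∈A)
      ... | inj₂ u∈B = ≤ₚ⇒∼ (single B) j (𝔹.y≤x∨y α β) (single-∼⁺ u∈B c∈B)

      ε≤α∨β : ε ⊑ α ∨ β
      ε≤α∨β = single-≤ j λ u∈E v∈E → trans (∼c u∈E) (sym (∼c v∈E))

      m : Partition n
      m = proj₁ (ε ∧ β)

      inBoth : ∀ {u v} → (u ∈ E × v ∈ E) ⊎ u ≡ v → (u ∈ B × v ∈ B) ⊎ u ≡ v → u ≡ v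
      inBoth (inj₂ u≡v)         _                  = u≡v
      inBoth (inj₁ _)           (inj₂ u≡v)         = u≡v
      inBoth (inj₁ (u∈E , v∈E)) (inj₁ (u∈B , v∈B)) =
        trans (E∩B u∈E u∈B) (sym (E∩B v∈E v∈B))

      ∼m⇒≡ : ∀ {u v} → u ∼[ m ] v → u ≡ v
      ∼m⇒≡ u∼v = inBoth
        (single-∼⁻ (≤ₚ⇒∼ m (single E) (𝔹.x∧y≤x ε β) u∼v))
        (single-∼⁻ (≤ₚ⇒∼ m (single B) (𝔹.x∧y≤y ε β) u∼v))

      ε∧β≤α : ε ∧ β ⊑ α
      ε∧β≤α = ∼⇒≤ₚ m (single A) λ u∼v → cong (block (single A)) (∼m⇒≡ u∼v)

      ε≤α : ε ⊑ α
      ε≤α = 𝔹.trans {ε} {ε ∧ (α ∨ β)} {α}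
        (𝔹.∧-greatest {ε} {ε} {α ∨ β} (𝔹.refl {ε}) ε≤α∨β)
        (𝔹.trans {ε ∧ (α ∨ β)} {ε ∧ α ∨ ε ∧ β} {α} (∧-distribˡ-∨-≤ ε α β)
          (𝔹.∨-least {ε ∧ α} {ε ∧ β} {α} (𝔹.x∧y≤y ε α) ε∧β≤α))

-- Spanning trees in which every set of the system is connected

smallest : {P : Pred (Subset n) 0ℓ} → Decidable P → ∀ {E} → P E →
           ∃[ F ] (P F × (∀ {G} → P G → ∣ F ∣ ≤ ∣ G ∣))
smallest {n} {P} P? {E} pE = go n E pE (∣p∣≤n E)
  where
  go : ∀ k F → P F → ∣ F ∣ ≤ k → ∃[ F ] (P F × (∀ {G} → P G → ∣ F ∣ ≤ ∣ G ∣))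
  go k F pF ∣F∣≤k with anySubset? (λ G → P? G ×-dec (∣ G ∣ <? ∣ F ∣))
  go k F pF ∣F∣≤k | no ∄G = F , pF , λ {G} pG → ≮⇒≥ λ G<F → ∄G (G , pG , G<F)
  go zero    F pF ∣F∣≤0 | yes (G , pG , G<F) with () ← <-≤-trans G<F ∣F∣≤0
  go (suc k) F pF ∣F∣≤k | yes (G , pG , G<F) = go k G pG (s≤s⁻¹ (≤-trans G<F ∣F∣≤k))

module Growth {m : ℕ} {I : Family (suc m)} (isSemiInterval : IsSemiIntervalSystem I)
  (boolean : IsBooleanLattice (subPoset (Part (suc m)) (𝓓 I))) where

  open SemiInterval isSemiInterval
  open BooleanSemiInterval isSemiInterval boolean

  Climbs : (Fin m → Fin (suc m)) → Subset (suc m) → Fin (suc m) → Set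
  Climbs parent A x = ∃[ i ] (x ≡ suc i × parent i ∈ A)

  -- The root is `zero`; outside `B` the values of `parent` and `height` carry no meaning. `linked`
  -- expresses that `A ∩ B` is connected in the tree: at most one of its points fails to have its
  -- parent in `A`.
  record Tree (B : Subset (suc m)) : Set where
    field
      parent   : Fin m → Fin (suc m)
      height   : Fin (suc m) → ℕ
      vertices : B ∈ᶠ I
      root∈    : zero ∈ B
      parent∈  : ∀ {i} → suc i ∈ B → parent i ∈ B
      descends : ∀ {i} → suc i ∈ B → height (parent i) < height (suc i)
      linked   : ∀ {A x y} → A ∈ᶠ I → x ∈ A → y ∈ A → x ∈ B → y ∈ B → x ≢ y →
                 Climbs parent A x ⊎ Climbs parent A y

  Ear : Subset (suc m) → Fin (suc m) → Pred (Subset (suc m)) 0ℓ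
  Ear B b E = E ∈ᶠ I × E ∩ B ≡ ⁅ b ⁆ × ∃[ x ] (x ∈ E × x ∉ B)

  ear? : ∀ B b → Decidable (Ear B b)
  ear? B b E = T? _ ×-dec ((E ∩ B) ≟ˢ ⁅ b ⁆) ×-dec any? λ x → (x ∈? E) ×-dec ¬? (x ∈? B)

  ear⁺ : ∀ {B b E x} → E ∈ᶠ I → b ∈ E → b ∈ B → (∀ {u} → u ∈ E → u ∈ B → u ≡ b) →
         x ∈ E → x ∉ B → Ear B b E
  ear⁺ {B} {b} {E} {x} E∈I b∈E b∈B only x∈E x∉B =
    E∈I , ⊆-antisym ⊆b b⊆ , x , x∈E , x∉B
    where
    ⊆b : E ∩ B ⊆ˢ ⁅ b ⁆
    ⊆b u∈ with u∈E , u∈B ← x∈p∩q⁻ E B u∈ =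
      subst (_∈ ⁅ b ⁆) (sym (only u∈E u∈B)) (x∈⁅x⁆ b)
    b⊆ : ⁅ b ⁆ ⊆ˢ E ∩ B
    b⊆ u∈ = subst (_∈ E ∩ B) (sym (x∈⁅y⁆⇒x≡y b u∈)) (x∈p∩q⁺ (b∈E , b∈B))

  -- The gate of `B` at `x` contains `x` and meets `B` in exactly one point.
  ear-exists : ∀ {B x} → B ∈ᶠ I → zero ∈ B → x ∉ B → ∃[ b ] ∃[ E ] Ear B b E
  ear-exists {x = x} B∈I 0∈B x∉B
    with G , G∈I , x∈G , (b , b∈G , b∈B) , once ← gate B∈I 0∈B x =
    b , G , ear⁺ G∈I b∈G b∈B (λ u∈G u∈B → once u∈G b∈G u∈B b∈B) x∈G x∉B

  module Extend {B : Subset (suc m)} (tree : Tree B) {b : Fin (suc m)} {E : Subset (suc m)}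
    (ear : Ear B b E) (least : ∀ {F} → Ear B b F → ∣ E ∣ ≤ ∣ F ∣) where

    open Tree tree

    E∈I : E ∈ᶠ I
    E∈I = proj₁ ear

    b∈E×B : b ∈ E × b ∈ B
    b∈E×B = x∈p∩q⁻ E B (subst (b ∈_) (sym (proj₁ (proj₂ ear))) (x∈⁅x⁆ b))

    b∈E : b ∈ E
    b∈E = proj₁ b∈E×B

    b∈B : b ∈ B
    b∈B = proj₂ b∈E×B

    only-b : ∀ {u} → u ∈ E → u ∈ B → u ≡ b
    only-b u∈E u∈B = x∈⁅y⁆⇒x≡y b (subst (_ ∈_) (proj₁ (proj₂ ear)) (x∈p∩q⁺ (u∈E , u∈B)))

    ∉B⇒≢b : ∀ {x} → x ∉ B → x ≢ b
    ∉B⇒≢b x∉B refl = x∉B b∈B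

    -- `attach` applies to `E ∩ (A ∪ B)` in place of `E`: this set lies inside `A ∪ B`, and in `I`
    -- because `A` and `B` share `y`.
    b∈-across : ∀ {A x y} → A ∈ᶠ I → x ∈ A → y ∈ A → x ∈ E → x ∉ B → y ∈ B → b ∈ A
    b∈-across {A} {x} {y} A∈I x∈A y∈A x∈E x∉B y∈B =
      attach {E = E ∩ (A ∪ B)} A∈I vertices (∩-closed E∈I A∪B∈I) y∈A y∈B
        (λ u∈ → proj₂ (x∈p∩q⁻ E (A ∪ B) u∈))
        (λ u∈ → only-b (proj₁ (x∈p∩q⁻ E (A ∪ B) u∈)))
        (x∈p∩q⁺ (b∈E , x∈p∪q⁺ (inj₂ b∈B)))
        (x∈p∩q⁺ (x∈E , x∈p∪q⁺ (inj₁ x∈A)))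
        (∉B⇒≢b x∉B)
      where
      A∪B∈I : A ∪ B ∈ᶠ I
      A∪B∈I = ∪-closed A∈I vertices (y , x∈p∩q⁺ (y∈A , y∈B))

    -- Otherwise the gate of E ∩ A at b would cut a smaller ear out of E.
    b∈-within : ∀ {A x y} → A ∈ᶠ I → x ∈ A → y ∈ A → x ∈ E → y ∈ E → x ≢ y → b ∈ A
    b∈-within {A} {x} {y} A∈I x∈A y∈A x∈E y∈E x≢y =
      decidable-stable (b ∈? A) λ b∉A → smaller b∉A
        (gate (∩-closed E∈I A∈I) (x∈p∩q⁺ (x∈E , x∈A)) b)
      where
      smaller : b ∉ A → ∃[ G ] (G ∈ᶠ I × b ∈ G × (∃[ g ] (g ∈ G × g ∈ E ∩ A))
                  × (∀ {u v} → u ∈ G → v ∈ G → u ∈ E ∩ A → v ∈ E ∩ A → u ≡ v)) → Empty.⊥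
      smaller b∉A (G , G∈I , b∈G , (g , g∈G , g∈EA) , once) =
        <⇒≱ (p⊂q⇒∣p∣<∣q∣ (p∩q⊆p E G , missed (x ∈? G) (y ∈? G))) (least ear′)
        where
        g∈E = proj₁ (x∈p∩q⁻ E A g∈EA)
        g∈A = proj₂ (x∈p∩q⁻ E A g∈EA)

        ear′ : Ear B b (E ∩ G)
        ear′ = ear⁺ (∩-closed E∈I G∈I) (x∈p∩q⁺ (b∈E , b∈G)) b∈B
          (λ u∈ → only-b (proj₁ (x∈p∩q⁻ E G u∈)))
          (x∈p∩q⁺ (g∈E , g∈G))
          -- The only point of `E` in `B` is `b`, which is not in `A`; so `g` witnesses that `E ∩ G`
          -- leaves `B`.
          (λ g∈B → b∉A (subst (_∈ A) (only-b g∈E g∈B) g∈A))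

        -- `G` meets `E ∩ A` only once, so it misses `x` or `y`, and `E ∩ G` is strictly smaller
        -- than `E`.
        missed : Dec (x ∈ G) → Dec (y ∈ G) → ∃[ z ] (z ∈ E × z ∉ E ∩ G)
        missed (no x∉G)  _         = x , x∈E , λ x∈ → x∉G (proj₂ (x∈p∩q⁻ E G x∈))
        missed (yes _)   (no y∉G)  = y , y∈E , λ y∈ → y∉G (proj₂ (x∈p∩q⁻ E G y∈))
        missed (yes x∈G) (yes y∈G) = contradiction
          (once x∈G y∈G (x∈p∩q⁺ (x∈E , x∈A)) (x∈p∩q⁺ (y∈E , y∈A))) x≢y

    -- Every point outside `B` is hung below `b`, even those outside `B ∪ E`, whose values a later
    -- extension overwrites. Parents thus always lie in `B`.
    parent′ : Fin m → Fin (suc m)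
    parent′ i with suc i ∈? B
    ... | yes _ = parent i
    ... | no  _ = b

    height′ : Fin (suc m) → ℕ
    height′ x with x ∈? B
    ... | yes _ = height x
    ... | no  _ = suc (height b)

    parent′-∈ : ∀ {i} → suc i ∈ B → parent′ i ≡ parent i
    parent′-∈ {i} i∈B with suc i ∈? B
    ... | yes _   = refl
    ... | no  i∉B = contradiction i∈B i∉B

    parent′-∉ : ∀ {i} → suc i ∉ B → parent′ i ≡ b
    parent′-∉ {i} i∉B with suc i ∈? B
    ... | yes i∈B = contradiction i∈B i∉B
    ... | no  _   = refl

    height′-∈ : ∀ {x} → x ∈ B → height′ x ≡ height x
    height′-∈ {x} x∈B with x ∈? B
    ... | yes _   = refl
    ... | no  x∉B = contradiction x∈B x∉B

    parent′∈B : ∀ i → parent′ i ∈ B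
    parent′∈B i with suc i ∈? B
    ... | yes i∈B = parent∈ i∈B
    ... | no  _   = b∈B

    descends′ : ∀ i → height′ (parent′ i) < height′ (suc i)
    descends′ i rewrite height′-∈ (parent′∈B i) with suc i ∈? B
    ... | yes i∈B = descends i∈B
    ... | no  _   = n<1+n _

    climbs-old : ∀ {A x} → x ∈ B → Climbs parent A x → Climbs parent′ A x
    climbs-old {A} x∈B (i , refl , p∈A) = i , refl , subst (_∈ A) (sym (parent′-∈ x∈B)) p∈A

    climbs-new : ∀ {A x} → x ∉ B → b ∈ A → Climbs parent′ A x
    climbs-new {x = zero}      x∉B _   = contradiction root∈ x∉B
    climbs-new {A} {x = suc i} x∉B b∈A = i , refl , subst (_∈ A) (sym (parent′-∉ x∉B)) b∈A

    ∉B⇒∈E : ∀ {x} → x ∈ B ∪ E → x ∉ B → x ∈ E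
    ∉B⇒∈E x∈ x∉B = [ (λ x∈B → contradiction x∈B x∉B) , (λ x∈E → x∈E) ]′ (x∈p∪q⁻ B E x∈)

    -- New vertices have parent `b`, so they climb in `A` once `b ∈ A`. With one new vertex this is
    -- `b∈-across`, with two it is `b∈-within`; two old vertices keep their old link.
    linked′ : ∀ {A x y} → A ∈ᶠ I → x ∈ A → y ∈ A → x ∈ B ∪ E → y ∈ B ∪ E → x ≢ y →
              Climbs parent′ A x ⊎ Climbs parent′ A y
    linked′ {A} {x} {y} A∈I x∈A y∈A x∈ y∈ x≢y with x ∈? B | y ∈? B
    ... | yes x∈B | yes y∈B =
      [ (λ c → inj₁ (climbs-old x∈B c)) , (λ c → inj₂ (climbs-old y∈B c)) ]′
        (linked A∈I x∈A y∈A x∈B y∈B x≢y)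
    ... | no  x∉B | yes y∈B = inj₁ (climbs-new x∉B
                                (b∈-across A∈I x∈A y∈A (∉B⇒∈E x∈ x∉B) x∉B y∈B))
    ... | yes x∈B | no  y∉B = inj₂ (climbs-new y∉B
                                (b∈-across A∈I y∈A x∈A (∉B⇒∈E y∈ y∉B) y∉B x∈B))
    ... | no  x∉B | no  y∉B = inj₁ (climbs-new x∉B
                                (b∈-within A∈I x∈A y∈A (∉B⇒∈E x∈ x∉B) (∉B⇒∈E y∈ y∉B) x≢y))

    extended : Tree (B ∪ E)
    extended = record
      { parent   = parent′
      ; height   = height′
      ; vertices = ∪-closed vertices E∈I (b , x∈p∩q⁺ (b∈B , b∈E))
      ; root∈    = x∈p∪q⁺ (inj₁ root∈)
      ; parent∈  = λ {i} _ → x∈p∪q⁺ (inj₁ (parent′∈B i))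
      ; descends = λ {i} _ → descends′ i
      ; linked   = linked′
      }

    ∣B∣<∣B∪E∣ : ∣ B ∣ < ∣ B ∪ E ∣
    ∣B∣<∣B∪E∣ with x , x∈E , x∉B ← proj₂ (proj₂ ear) =
      p⊂q⇒∣p∣<∣q∣ (p⊆p∪q E , x , x∈p∪q⁺ (inj₂ x∈E) , x∉B)

  seed : Tree ⁅ zero ⁆
  seed = record
    { parent   = λ _ → zero
    ; height   = λ _ → 0
    ; vertices = singleton-∈ zero
    ; root∈    = x∈⁅x⁆ zero
    ; parent∈  = λ _ → x∈⁅x⁆ zero
    ; descends = λ i∈ → contradiction (x∈⁅y⁆⇒x≡y zero i∈) λ ()
    ; linked   = λ _ _ _ x∈ y∈ x≢y →
        contradiction (trans (x∈⁅y⁆⇒x≡y zero x∈) (sym (x∈⁅y⁆⇒x≡y zero y∈))) x≢y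
    }

  extend : ∀ {B x} → Tree B → x ∉ B → ∃[ C ] (Tree C × ∣ B ∣ < ∣ C ∣)
  extend {B} tree x∉B
    with b , _ , ear₀ ← ear-exists (Tree.vertices tree) (Tree.root∈ tree) x∉B
    with E , ear , least ← smallest (ear? B b) ear₀ =
    B ∪ E , Extend.extended tree ear least , Extend.∣B∣<∣B∪E∣ tree ear least

  -- `k` bounds the number of vertices still missing, and each ear adds at least one.
  grow : ∀ k {B} → Tree B → suc m ≤ k + ∣ B ∣ → Tree ⊤
  grow zero    {B} tree n≤∣B∣ = subst Tree (∣p∣≡n⇒p≡⊤ (≤-antisym (∣p∣≤n B) n≤∣B∣)) tree
  grow (suc k) {B} tree n≤ with any? (λ x → ¬? (x ∈? B))
  ... | no  ∄x        = subst Tree (⊆-antisym (λ _ → ∈⊤) λ {x} _ →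
                          decidable-stable (x ∈? B) λ x∉B → ∄x (x , x∉B)) tree
  ... | yes (x , x∉B) with C , tree′ , B<C ← extend tree x∉B =
    grow k tree′ (≤-trans n≤ (≤-trans (≤-reflexive (sym (+-suc k ∣ B ∣))) (+-monoʳ-≤ k B<C)))

  opaque
    spanningTree : Tree ⊤
    spanningTree = grow (suc m) seed (m≤m+n _ _)

-- The Boolean sublattice of a rooted tree

funToFin-cong : ∀ {m n} {f g : Fin m → Fin n} → f ≗ g → funToFin f ≡ funToFin g
funToFin-cong {zero}  _   = refl
funToFin-cong {suc m} f≗g = cong₂ combine (f≗g zero) (funToFin-cong (f≗g ∘ suc))

-- Binary digits give a bijection between numbers and edge sets, with which `hasSize` counts the
-- forests.
decode : ∀ {m} → Fin (2 ^ m) → Subset m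
decode k = tabulate (Inverse.to 2↔Bool ∘ finToFun k)

decode-injective : ∀ {m} {k l : Fin (2 ^ m)} → decode k ≡ decode l → k ≡ l
decode-injective {m} {k} {l} eq =
  trans (sym (funToFin-finToFin {m} k)) (trans (funToFin-cong same) (funToFin-finToFin {m} l))
  where
  same : finToFun {2} {m} k ≗ finToFun l
  same i = trans (sym (Inverse.strictlyInverseʳ 2↔Bool _)) (trans
    (cong (Inverse.from 2↔Bool) (trans (sym (lookup∘tabulate _ i))
      (trans (cong (λ S → lookup S i) eq) (lookup∘tabulate _ i))))
    (Inverse.strictlyInverseʳ 2↔Bool _))

decode-surjective : ∀ {m} (S : Subset m) → ∃[ k ] decode k ≡ S
decode-surjective S = funToFin (Inverse.from 2↔Bool ∘ lookup S) ,
  trans (tabulate-cong λ i → trans (cong (Inverse.to 2↔Bool) (finToFun-funToFin _ i))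
                                   (Inverse.strictlyInverseˡ 2↔Bool _))
        (tabulate∘lookup S)

module RootedTree {m : ℕ} (parent : Fin m → Fin (suc m)) (height : Fin (suc m) → ℕ)
  (descends : ∀ i → height (parent i) < height (suc i)) where

  -- The edge from suc i to its parent is named i, so a forest is an S : Subset m.
  data Climb (S : Subset m) : Fin (suc m) → Fin (suc m) → Set where
    root : Climb S zero zero
    stop : ∀ {i} → i ∉ S → Climb S (suc i) (suc i)
    step : ∀ {i y} → i ∈ S → Climb S (parent i) y → Climb S (suc i) y

  climb-unique : ∀ {S x y z} → Climb S x y → Climb S x z → y ≡ z
  climb-unique root         root         = refl
  climb-unique (stop _)     (stop _)     = refl
  climb-unique (stop i∉S)   (step i∈S _) = contradiction i∈S i∉S
  climb-unique (step i∈S _) (stop i∉S)   = contradiction i∈S i∉S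
  climb-unique (step _ c)   (step _ d)   = climb-unique c d

  climb : ∀ S x → Acc _<_ (height x) → ∃[ y ] Climb S x y
  climb S zero    _         = zero , root
  climb S (suc i) (acc rec) with i ∈? S
  ... | no  i∉S = suc i , stop i∉S
  ... | yes i∈S with y , c ← climb S (parent i) (rec (descends i)) = y , step i∈S c

  opaque
    top : Subset m → Fin (suc m) → Fin (suc m)
    top S x = proj₁ (climb S x (<-wellFounded (height x)))

    climb-top : ∀ S x → Climb S x (top S x)
    climb-top S x = proj₂ (climb S x (<-wellFounded (height x)))

  climb⇒top : ∀ {S x y} → Climb S x y → top S x ≡ y
  climb⇒top c = climb-unique (climb-top _ _) c

  climb-height : ∀ {S x y} → Climb S x y → x ≡ y ⊎ height y < height x
  climb-height root       = inj₁ refl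
  climb-height (stop _)   = inj₁ refl
  climb-height (step {i} _ c) with climb-height c
  ... | inj₁ refl = inj₂ (descends i)
  ... | inj₂ y<p  = inj₂ (<-trans y<p (descends i))

  climb-end : ∀ {S x y} → Climb S x y → Climb S y y
  climb-end root       = root
  climb-end (stop i∉S) = stop i∉S
  climb-end (step _ c) = climb-end c

  -- A `step` leads strictly below the height of `suc i`, and no climb gains height.
  end-∉ : ∀ {S i} → Climb S (suc i) (suc i) → i ∉ S
  end-∉ (stop i∉S)         = i∉S
  end-∉ {i = i} (step _ c) with climb-height c
  ... | inj₁ p≡i = contradiction (descends i) (<-irrefl (cong height p≡i))
  ... | inj₂ i<p = contradiction i<p (<-asym (descends i))

  -- The connected components of the edge set `S`, each labelled by its vertex nearest the root.
  forest : Subset m → Partition (suc m)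
  forest S = kernel _≟ᶠ_ (top S)

  ∼-forest⁺ : ∀ {S x y} → top S x ≡ top S y → x ∼[ forest S ] y
  ∼-forest⁺ = ∼-kernel⁺ _≟ᶠ_ (top _)

  ∼-forest⁻ : ∀ {S x y} → x ∼[ forest S ] y → top S x ≡ top S y
  ∼-forest⁻ = ∼-kernel⁻ _≟ᶠ_ (top _)

  edge-∼ : ∀ {S i} → i ∈ S → suc i ∼[ forest S ] parent i
  edge-∼ i∈S = ∼-forest⁺ (climb⇒top (step i∈S (climb-top _ _)))

  module _ (π : Partition (suc m)) {S : Subset m}
           (edges : ∀ {i} → i ∈ S → suc i ∼[ π ] parent i) where

    climb⇒∼ : ∀ {x y} → Climb S x y → x ∼[ π ] y
    climb⇒∼ root         = refl
    climb⇒∼ (stop _)     = refl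
    climb⇒∼ (step i∈S c) = trans (edges i∈S) (climb⇒∼ c)

    top-∼ : ∀ x → x ∼[ π ] top S x
    top-∼ x = climb⇒∼ (climb-top S x)

    -- Every point is joined to its top by edges of `S`, which `π` respects. So `forest S` is the
    -- least partition relating the ends of these edges, which yields joins in all of `Part`.
    forest-≤ : forest S ≤ₚ π
    forest-≤ = ∼⇒≤ₚ (forest S) π λ {x} {y} x∼y →
      trans (top-∼ x) (trans (cong (block π) (∼-forest⁻ x∼y)) (sym (top-∼ y)))

  forest-mono : ∀ {S T} → S ⊆ˢ T → forest S ≤ₚ forest T
  forest-mono {S} {T} S⊆T = forest-≤ (forest T) λ i∈S → edge-∼ (S⊆T i∈S)

  -- If `i ∈ S` were outside `T`, then `suc i` would be its own top in `T`, and `parent i`, in the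
  -- same component of `T`, would have to climb to the greater height of `suc i`.
  forest-reflects : ∀ {S T} → forest S ≤ₚ forest T → S ⊆ˢ T
  forest-reflects {S} {T} S≤T {i} i∈S = decidable-stable (i ∈? T) λ i∉T →
    higher (climb-height (subst (Climb T (parent i))
      (trans (sym (∼-forest⁻ (≤ₚ⇒∼ (forest S) (forest T) S≤T (edge-∼ i∈S)))) (climb⇒top (stop i∉T)))
      (climb-top T (parent i))))
    where
    higher : parent i ≡ suc i ⊎ height (suc i) < height (parent i) → Empty.⊥
    higher (inj₁ p≡i) = <-irrefl (cong height p≡i) (descends i)
    higher (inj₂ i<p) = <-asym (descends i) i<p

  end-∩ : ∀ {S T x} → Climb (S ∩ T) x x → Climb S x x ⊎ Climb T x x
  end-∩ {x = zero}          _ = inj₁ root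
  end-∩ {S} {T} {x = suc i} c with i ∈? S | i ∈? T
  ... | no  i∉S | _       = inj₁ (stop i∉S)
  ... | yes _   | no  i∉T = inj₂ (stop i∉T)
  ... | yes i∈S | yes i∈T = contradiction (x∈p∩q⁺ (i∈S , i∈T)) (end-∉ c)

  -- If x tops its tree in S and y tops its tree in T, each lies above the other.
  tops-≡ : ∀ {S T x y} → top S x ≡ top S y → top T x ≡ top T y →
           Climb S x x → Climb T y y → x ≡ y
  tops-≡ {S} {T} {x} {y} Sxy Txy Sxx Tyy
    with climb-height (subst (Climb S y) (trans (sym Sxy) (climb⇒top Sxx)) (climb-top S y))
       | climb-height (subst (Climb T x) (trans Txy (climb⇒top Tyy)) (climb-top T x))
  ... | inj₁ y≡x | _        = sym y≡x
  ... | inj₂ _   | inj₁ x≡y = x≡y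
  ... | inj₂ x<y | inj₂ y<x = contradiction y<x (<-asym x<y)

  ends-≡ : ∀ {S T x y} → top S x ≡ top S y → top T x ≡ top T y →
           Climb (S ∩ T) x x → Climb (S ∩ T) y y → x ≡ y
  ends-≡ Sxy Txy cx cy with end-∩ cx | end-∩ cy
  ... | inj₁ Sx | inj₁ Sy = trans (sym (climb⇒top Sx)) (trans Sxy (climb⇒top Sy))
  ... | inj₂ Tx | inj₂ Ty = trans (sym (climb⇒top Tx)) (trans Txy (climb⇒top Ty))
  ... | inj₁ Sx | inj₂ Ty = tops-≡ Sxy Txy Sx Ty
  ... | inj₂ Tx | inj₁ Sy = tops-≡ Txy Sxy Tx Sy

  -- This makes `forest (S ∩ T)` the meet in `Part`. Moving `x` and `y` to their tops in `S ∩ T`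
  -- keeps them related in both forests; each of these tops is also a top in `S` or in `T`, and
  -- `ends-≡` identifies them.
  ∼-∩ : ∀ {S T x y} → x ∼[ forest S ] y → x ∼[ forest T ] y → x ∼[ forest (S ∩ T) ] y
  ∼-∩ {S} {T} {x} {y} Sxy Txy = ∼-forest⁺ (ends-≡
    (∼-forest⁻ (ends∼ S (λ {i} → p∩q⊆p S T) Sxy))
    (∼-forest⁻ (ends∼ T (λ {i} → p∩q⊆q S T) Txy))
    (climb-end (climb-top (S ∩ T) x)) (climb-end (climb-top (S ∩ T) y)))
    where
    ends∼ : ∀ R → S ∩ T ⊆ˢ R → x ∼[ forest R ] y → top (S ∩ T) x ∼[ forest R ] top (S ∩ T) y
    ends∼ R ⊆R x∼y = trans (sym (top-∼ (forest R) (λ i∈ → edge-∼ (⊆R i∈)) x))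
      (trans x∼y (top-∼ (forest R) (λ i∈ → edge-∼ (⊆R i∈)) y))

  -- Taken up to `≈ₚ`, since a sublattice must respect equality; `S` is still determined, by
  -- `forest-reflects`.
  Forest : Pred (Partition (suc m)) 0ℓ
  Forest π = ∃[ S ] forest S ≈ₚ π

  private
    module P = Poset (Part (suc m))
    module F = Poset (subPoset (Part (suc m)) Forest)

  forest∈ : ∀ S → Forest (forest S)
  forest∈ S = S , P.Eq.refl {forest S}

  ⟦_⟧ : Subset m → F.Carrier
  ⟦ S ⟧ = forest S , forest∈ S

  edges : F.Carrier → Subset m
  edges (_ , S , _) = S

  -- Together with `edges-reflects` this makes `edges` an order isomorphism onto the subsets of
  -- `Fin m`, whose Boolean structure is transported along it.
  edges-mono : ∀ {π σ} → π F.≤ σ → edges π ⊆ˢ edges σ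
  edges-mono {π , S , S≈π} {σ , T , T≈σ} π≤σ = forest-reflects
    (P.trans {forest S} {π} {forest T} (P.reflexive {forest S} {π} S≈π)
      (P.trans {π} {σ} {forest T} π≤σ (P.reflexive {σ} {forest T} (P.Eq.sym {forest T} {σ} T≈σ))))

  edges-reflects : ∀ {π σ} → edges π ⊆ˢ edges σ → π F.≤ σ
  edges-reflects {π , S , S≈π} {σ , T , T≈σ} S⊆T =
    P.trans {π} {forest S} {σ} (P.reflexive {π} {forest S} (P.Eq.sym {forest S} {π} S≈π))
      (P.trans {forest S} {forest T} {σ} (forest-mono S⊆T) (P.reflexive {forest T} {σ} T≈σ))

  isBooleanLattice : IsBooleanLattice (subPoset (Part (suc m)) Forest)
  isBooleanLattice = record
    { join = λ π σ → ⟦ edges π ∪ edges σ ⟧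
    ; meet = λ π σ → ⟦ edges π ∩ edges σ ⟧
    ; complement = λ π → ⟦ ∁ (edges π) ⟧
    ; top = ⟦ ⊤ ⟧
    ; bottom = ⟦ ⊥ ⟧
    ; isBooleanAlgebra = record { isHeytingAlgebra = record
      { isBoundedLattice = record
        { isLattice = record
          { isPartialOrder = F.isPartialOrder
          ; supremum = λ π σ →
              edges-reflects {π} {⟦ edges π ∪ edges σ ⟧} (p⊆p∪q (edges σ)) ,
              edges-reflects {σ} {⟦ edges π ∪ edges σ ⟧} (q⊆p∪q (edges π) (edges σ)) ,
              λ τ π≤τ σ≤τ → edges-reflects {⟦ edges π ∪ edges σ ⟧} {τ} λ i∈ →
                [ edges-mono {π} {τ} π≤τ , edges-mono {σ} {τ} σ≤τ ]′
                  (x∈p∪q⁻ (edges π) (edges σ) i∈)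
          ; infimum = λ π σ →
              edges-reflects {⟦ edges π ∩ edges σ ⟧} {π} (p∩q⊆p (edges π) (edges σ)) ,
              edges-reflects {⟦ edges π ∩ edges σ ⟧} {σ} (p∩q⊆q (edges π) (edges σ)) ,
              λ τ τ≤π τ≤σ → edges-reflects {τ} {⟦ edges π ∩ edges σ ⟧} λ i∈ →
                x∈p∩q⁺ (edges-mono {τ} {π} τ≤π i∈ , edges-mono {τ} {σ} τ≤σ i∈)
          }
        ; maximum = λ π → edges-reflects {π} {⟦ ⊤ ⟧} ⊆-max′
        ; minimum = λ π → edges-reflects {⟦ ⊥ ⟧} {π} (⊆-min (edges π))
        }
      ; exponential = λ τ π σ →
          (λ τ∧π≤σ → edges-reflects {τ} {⟦ ∁ (edges π) ∪ edges σ ⟧} λ {i} i∈τ → x∈p∪q⁺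
            ([ (λ i∈π → inj₂ (edges-mono {⟦ edges τ ∩ edges π ⟧} {σ} τ∧π≤σ
                                (x∈p∩q⁺ (i∈τ , i∈π))))
             , (λ i∉π → inj₁ (x∉p⇒x∈∁p i∉π)) ]′ (toSum (i ∈? edges π)))) ,
          (λ τ≤π⇨σ → edges-reflects {⟦ edges τ ∩ edges π ⟧} {σ} λ i∈ →
            [ (λ i∈∁π → contradiction (p∩q⊆q (edges τ) (edges π) i∈) (x∈∁p⇒x∉p i∈∁π))
            , (λ i∈σ → i∈σ) ]′
            (x∈p∪q⁻ (∁ (edges π)) (edges σ)
              (edges-mono {τ} {⟦ ∁ (edges π) ∪ edges σ ⟧} τ≤π⇨σ (p∩q⊆p (edges τ) (edges π) i∈))))
      } }
    }
    where
    ⊆-max′ : ∀ {S : Subset m} → S ⊆ˢ ⊤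
    ⊆-max′ _ = ∈⊤

  isBooleanSublattice : IsBooleanSublattice (Part (suc m)) Forest
  isBooleanSublattice = record
    { isSublattice = record
      { respects    = λ {π} {σ} π≈σ (S , S≈π) → S , P.Eq.trans {forest S} {π} {σ} S≈π π≈σ
      ; meet-closed = λ {π} {σ} (S , S≈π) (T , T≈σ) →
          let p = π , S , S≈π ; q = σ , T , T≈σ in
          forest (S ∩ T) , forest∈ (S ∩ T) ,
          edges-reflects {⟦ S ∩ T ⟧} {p} (p∩q⊆p S T) ,
          edges-reflects {⟦ S ∩ T ⟧} {q} (p∩q⊆q S T) ,
          -- Here `τ` is any partition, not only a forest, so comparing edge sets does not suffice.
          -- The same holds for the join below.
          λ τ τ≤π τ≤σ → ∼⇒≤ₚ τ (forest (S ∩ T)) λ x∼y → ∼-∩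
            (≤ₚ⇒∼ π (forest S) (edges-reflects {p} {⟦ S ⟧} λ i∈ → i∈) (≤ₚ⇒∼ τ π τ≤π x∼y))
            (≤ₚ⇒∼ σ (forest T) (edges-reflects {q} {⟦ T ⟧} λ i∈ → i∈) (≤ₚ⇒∼ τ σ τ≤σ x∼y))
      ; join-closed = λ {π} {σ} (S , S≈π) (T , T≈σ) →
          let p = π , S , S≈π ; q = σ , T , T≈σ in
          forest (S ∪ T) , forest∈ (S ∪ T) ,
          edges-reflects {p} {⟦ S ∪ T ⟧} (p⊆p∪q T) ,
          edges-reflects {q} {⟦ S ∪ T ⟧} (q⊆p∪q S T) ,
          λ τ π≤τ σ≤τ → forest-≤ τ λ i∈ →
            [ (λ i∈S → ≤ₚ⇒∼ π τ π≤τ (≤ₚ⇒∼ (forest S) π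
                (edges-reflects {⟦ S ⟧} {p} λ i∈ → i∈) (edge-∼ i∈S)))
            , (λ i∈T → ≤ₚ⇒∼ σ τ σ≤τ (≤ₚ⇒∼ (forest T) σ
                (edges-reflects {⟦ T ⟧} {q} λ i∈ → i∈) (edge-∼ i∈T)))
            ]′ (x∈p∪q⁻ S T i∈)
      }
    ; isBooleanLattice = isBooleanLattice
    }

  hasSize : HasSize (Part (suc m)) Forest (2 ^ m)
  hasSize = record
    { to        = λ k → ⟦ decode k ⟧
    ; cong      = λ { {k} refl → P.Eq.refl {forest (decode k)} }
    ; bijective = injective , surjective
    }
    where
    injective : ∀ {k l} → forest (decode k) ≈ₚ forest (decode l) → k ≡ l
    injective {k} {l} k≈l = decode-injective (⊆-antisym
      (forest-reflects (P.reflexive {forest (decode k)} {forest (decode l)} k≈l))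
      (forest-reflects (P.reflexive {forest (decode l)} {forest (decode k)}
        (P.Eq.sym {forest (decode k)} {forest (decode l)} k≈l))))

    surjective : ∀ (p : F.Carrier) → ∃[ k ] (∀ {l} → l ≡ k → forest (decode l) ≈ₚ proj₁ p)
    surjective (π , S , S≈π) with k , refl ← decode-surjective S = k , λ { refl → S≈π }

  module _ (π : Partition (suc m))
    (linked : ∀ {x y} → x ∼[ π ] y → x ≢ y →
              (∃[ i ] (x ≡ suc i × x ∼[ π ] parent i)) ⊎ (∃[ i ] (y ≡ suc i × y ∼[ π ] parent i)))
    where

    private
      inner? : Decidable λ i → suc i ∼[ π ] parent i
      inner? i = block π (suc i) ≟ˢ block π (parent i)

      S : Subset m
      S = subset inner?

      end-isolated : ∀ {x} → Climb S x x → ∀ {i} → x ≡ suc i → x ∼[ π ] parent i → Empty.⊥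
      end-isolated c refl x∼p = end-∉ c (∈-subset⁺ inner? x∼p)

      ends-≡′ : ∀ {x y} → Climb S x x → Climb S y y → x ∼[ π ] y → x ≡ y
      ends-≡′ {x} {y} cx cy x∼y = decidable-stable (x ≟ᶠ y) λ x≢y →
        [ (λ (i , x≡i , x∼p) → end-isolated cx x≡i x∼p)
        , (λ (i , y≡i , y∼p) → end-isolated cy y≡i y∼p) ]′ (linked x∼y x≢y)

    -- `S` consists of the edges inside blocks of `π`. A top of `S` has no parent in its own block,
    -- so by `linked` each block contains only one top and is a single component.
    linked⇒Forest : Forest π
    linked⇒Forest = S , P.antisym {forest S} {π} (forest-≤ π (∈-subset⁻ inner?))
      (∼⇒≤ₚ π (forest S) λ {x} {y} x∼y → ∼-forest⁺ (ends-≡′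
        (climb-end (climb-top S x)) (climb-end (climb-top S y))
        (trans (sym (top-∼ π (∈-subset⁻ inner?) x)) (trans x∼y (top-∼ π (∈-subset⁻ inner?) y)))))

-- The size of Boolean sublattices

infix 4 _≤ₚ?_

_≤ₚ?_ : Decidable₂ (_≤ₚ_ {n})
π ≤ₚ? σ = map′
  (λ ∼⇒∼ → ∼⇒≤ₚ π σ λ {x} {y} → ∼⇒∼ x y)
  (λ π≤σ x y → ≤ₚ⇒∼ π σ π≤σ)
  (all? λ x → all? λ y → (block π x ≟ˢ block π y) →-dec (block σ x ≟ˢ block σ y))

-- Dropping the least point of each block leaves a set whose size is the rank. Coarsening enlarges
-- this set, so ranks are compared by inclusion.
NonLeast : Partition n → Pred (Fin n) 0ℓ
NonLeast π x = ∃[ y ] (y <ᶠ x × y ∼[ π ] x)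

nonLeast? : (π : Partition n) → Decidable (NonLeast π)
nonLeast? π x = any? λ y → (y <ᶠ? x) ×-dec (block π y ≟ˢ block π x)

opaque
  nonLeasts : Partition n → Subset n
  nonLeasts π = subset (nonLeast? π)

  ∈-nonLeasts⁺ : ∀ {π : Partition n} {x} → NonLeast π x → x ∈ nonLeasts π
  ∈-nonLeasts⁺ {π = π} = ∈-subset⁺ (nonLeast? π)

  ∈-nonLeasts⁻ : ∀ {π : Partition n} {x} → x ∈ nonLeasts π → NonLeast π x
  ∈-nonLeasts⁻ {π = π} = ∈-subset⁻ (nonLeast? π)

-- The number of elements minus the number of blocks.
rank : Partition n → ℕ
rank π = ∣ nonLeasts π ∣

least-∼ : ∀ (π : Partition n) x → Acc _<ᶠ_ x → ∃[ y ] (y ∉ nonLeasts π × y ∼[ π ] x)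
least-∼ π x (acc rec) with x ∈? nonLeasts π
... | no  x∉ = x , x∉ , refl
... | yes x∈ with y , y<x , y∼x ← ∈-nonLeasts⁻ {π = π} x∈
             with z , z∉ , z∼y ← least-∼ π y (rec y<x) = z , z∉ , trans z∼y y∼x

least-unique : ∀ (π : Partition n) {x y} → x ∉ nonLeasts π → y ∉ nonLeasts π →
               x ∼[ π ] y → x ≡ y
least-unique π {x} {y} x∉ y∉ x∼y with <ᶠ-cmp x y
... | tri< x<y _ _ = contradiction (∈-nonLeasts⁺ {π = π} (x , x<y , x∼y)) y∉
... | tri≈ _ x≡y _ = x≡y
... | tri> _ _ y<x = contradiction (∈-nonLeasts⁺ {π = π} (y , y<x , sym x∼y)) x∉

nonLeasts-mono : ∀ {π σ : Partition n} → π ≤ₚ σ → nonLeasts π ⊆ˢ nonLeasts σ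
nonLeasts-mono {π = π} {σ} π≤σ x∈ with y , y<x , y∼x ← ∈-nonLeasts⁻ {π = π} x∈ =
  ∈-nonLeasts⁺ {π = σ} (y , y<x , ≤ₚ⇒∼ π σ π≤σ y∼x)

-- For `x ∼[ σ ] y`, the least points `u` and `v` of the `π`-blocks of `x` and `y` are also least in
-- their `σ`-blocks. These coincide, so `u` and `v` do.
nonLeasts-reflects : ∀ {π σ : Partition n} → π ≤ₚ σ → nonLeasts σ ⊆ˢ nonLeasts π → σ ≤ₚ π
nonLeasts-reflects {n} {π = π} {σ} π≤σ σ⊆π = ∼⇒≤ₚ σ π related
  where
  related : ∀ {x y} → x ∼[ σ ] y → x ∼[ π ] y
  related {x} {y} x∼y
    with u , u∉ , u∼x ← least-∼ π x (<ᶠ-wellFounded x)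
       | v , v∉ , v∼y ← least-∼ π y (<ᶠ-wellFounded y)
    with refl ← least-unique σ (u∉ ∘ σ⊆π) (v∉ ∘ σ⊆π)
                  (trans (≤ₚ⇒∼ π σ π≤σ u∼x) (trans x∼y (sym (≤ₚ⇒∼ π σ π≤σ v∼y)))) =
    trans (sym u∼x) v∼y

rank-mono : ∀ {π σ : Partition n} → π ≤ₚ σ → rank π ≤ rank σ
rank-mono {π = π} {σ} π≤σ = p⊆q⇒∣p∣≤∣q∣ (nonLeasts-mono {π = π} {σ} π≤σ)

rank-strict : ∀ {π σ : Partition n} → π ≤ₚ σ → ¬ σ ≤ₚ π → rank π < rank σ
rank-strict {π = π} {σ} π≤σ σ≰π
  with any? (λ x → (x ∈? nonLeasts σ) ×-dec ¬? (x ∈? nonLeasts π))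
... | yes new = p⊂q⇒∣p∣<∣q∣ (nonLeasts-mono {π = π} {σ} π≤σ , new)
... | no ∄new = contradiction (nonLeasts-reflects {π = π} {σ} π≤σ λ {x} x∈ →
                  decidable-stable (x ∈? nonLeasts π) λ x∉ → ∄new (x , x∈ , x∉)) σ≰π

-- `zero` is always least in its block and is never counted.
rank≤ : ∀ {m} (π : Partition (suc m)) → rank π ≤ m
rank≤ {m} π = s≤s⁻¹ (subst (rank π <_) (∣⊤∣≡n (suc m))
  (p⊂q⇒∣p∣<∣q∣ ((λ _ → ∈⊤) , zero , ∈⊤ , zero∉)))
  where
  zero∉ : zero ∉ nonLeasts π
  zero∉ 0∈ with _ , () , _ ← ∈-nonLeasts⁻ {π = π} 0∈

2^-∸-* : ∀ {a b c} → a ≤ c → c ≤ b → 2 ^ (c ∸ a) * 2 ^ (b ∸ c) ≡ 2 ^ (b ∸ a)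
2^-∸-* {a} {b} {c} a≤c c≤b = trans (sym (^-distribˡ-+-* 2 (c ∸ a) (b ∸ c)))
  (cong (2 ^_) (trans (+-comm (c ∸ a) (b ∸ c))
    (trans (sym (+-∸-assoc (b ∸ c) a≤c)) (cong (_∸ a) (m∸n+n≡m c≤b)))))

-- Coding the intervals of a Boolean sublattice

module SizeBound {m : ℕ} {B : Pred (Partition (suc m)) 0ℓ}
  (boolean : IsBooleanLattice (subPoset (Part (suc m)) B))
  {k : ℕ} (size : HasSize (Part (suc m)) B k) where

  open IsBooleanLattice boolean using (isBooleanAlgebra)

  private
    𝔹 : BooleanAlgebra _ _ _
    𝔹 = record { isBooleanAlgebra = isBooleanAlgebra }
    module 𝔹 = BooleanAlgebra 𝔹
  open 𝔹 using (Carrier; _∧_; _∨_) renaming (_≤_ to _⊑_)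
  open HeytingProperties 𝔹.heytingAlgebra using (∧-distribˡ-∨-≤)

  private
    rk : Carrier → ℕ
    rk x = rank (proj₁ x)

    _⊑?_ : Decidable₂ _⊑_
    x ⊑? y = proj₁ x ≤ₚ? proj₁ y

    enum : Fin k → Carrier
    enum = Bijection.to size

    -- `x` lies below `x ∧ (y ∨ c)`, which distributes into `x ∧ y` and `x ∧ c`, both below `y`.
    ∧∨-cancel : ∀ {x y c} → x ∧ c ⊑ y ∧ c → x ∨ c ⊑ y ∨ c → x ⊑ y
    ∧∨-cancel {x} {y} {c} ∧⊑ ∨⊑ =
      𝔹.trans {x} {x ∧ (y ∨ c)} {y}
        (𝔹.∧-greatest {x} {x} {y ∨ c} (𝔹.refl {x})
          (𝔹.trans {x} {x ∨ c} {y ∨ c} (𝔹.x≤x∨y x c) ∨⊑))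
        (𝔹.trans {x ∧ (y ∨ c)} {x ∧ y ∨ x ∧ c} {y} (∧-distribˡ-∨-≤ x y c)
          (𝔹.∨-least {x ∧ y} {x ∧ c} {y} (𝔹.x∧y≤y x y)
            (𝔹.trans {x ∧ c} {y ∧ c} {y} ∧⊑ (𝔹.x∧y≤x y c))))

  -- An injection of the interval from `a` to `b` into few codes. `encode` is total, but only
  -- `faithful` inside the interval; used in both directions, `faithful` gives equality.
  record Coding (a b : Carrier) : Set where
    field
      codes    : ℕ
      codes≤   : codes ≤ 2 ^ (rk b ∸ rk a)
      encode   : Carrier → Fin codes
      faithful : ∀ {x y} → a ⊑ x → x ⊑ b → a ⊑ y → y ⊑ b → encode x ≡ encode y → x ⊑ y

  Between : Carrier → Carrier → Pred Carrier 0ℓ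
  Between a b c = a ⊑ c × c ⊑ b × ¬ c ⊑ a × ¬ b ⊑ c

  between? : ∀ a b → Decidable (Between a b)
  between? a b c = (a ⊑? c) ×-dec (c ⊑? b) ×-dec ¬? (c ⊑? a) ×-dec ¬? (b ⊑? c)

  -- In a distributive lattice z is determined by z ∧ c and z ∨ c.
  coding-split : ∀ {a b c} → a ⊑ c → c ⊑ b → Coding a c → Coding c b → Coding a b
  coding-split {a} {b} {c} a⊑c c⊑b lower upper = record
    { codes    = L.codes * U.codes
    ; codes≤   = ≤-trans (*-mono-≤ L.codes≤ U.codes≤)
        (≤-reflexive (2^-∸-* {rk a} {rk b} {rk c} (rank-mono {π = proj₁ a} {proj₁ c} a⊑c)
                                  (rank-mono {π = proj₁ c} {proj₁ b} c⊑b)))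
    ; encode   = λ z → combine (L.encode (z ∧ c)) (U.encode (z ∨ c))
    ; faithful = λ {x} {y} a⊑x x⊑b a⊑y y⊑b same →
        let same∧ , same∨ = combine-injective (L.encode (x ∧ c)) (U.encode (x ∨ c))
                                              (L.encode (y ∧ c)) (U.encode (y ∨ c)) same in
        ∧∨-cancel {x} {y} {c}
          (L.faithful {x ∧ c} {y ∧ c}
            (𝔹.∧-greatest {a} {x} {c} a⊑x a⊑c) (𝔹.x∧y≤y x c)
            (𝔹.∧-greatest {a} {y} {c} a⊑y a⊑c) (𝔹.x∧y≤y y c) same∧)
          (U.faithful {x ∨ c} {y ∨ c}
            (𝔹.y≤x∨y x c) (𝔹.∨-least {x} {c} {b} x⊑b c⊑b)
            (𝔹.y≤x∨y y c) (𝔹.∨-least {y} {c} {b} y⊑b c⊑b) same∨)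
    }
    where
    module L = Coding lower
    module U = Coding upper

  coding-trivial : ∀ {a b} → b ⊑ a → Coding a b
  coding-trivial {a} {b} b⊑a = record
    { codes    = 1
    ; codes≤   = m^n>0 2 (rk b ∸ rk a)
    ; encode   = λ _ → zero
    ; faithful = λ {x} {y} _ x⊑b a⊑y _ _ →
        𝔹.trans {x} {b} {y} x⊑b (𝔹.trans {b} {a} {y} b⊑a a⊑y)
    }

  -- The interval consists of `a` and `b` alone, told apart by testing `z ⊑ a`; the strict rise in
  -- rank leaves room for two codes.
  coding-cover : ∀ {a b} → a ⊑ b → ¬ b ⊑ a → (∀ c → ¬ Between a b c) → Coding a b
  coding-cover {a} {b} a⊑b b⋢a cover = record
    { codes    = 2
    ; codes≤   = ^-monoʳ-≤ 2 (m<n⇒0<n∸m (rank-strict {π = proj₁ a} {proj₁ b} a⊑b b⋢a))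
    ; encode   = encode
    ; faithful = faithful
    }
    where
    encode : Carrier → Fin 2
    encode z with z ⊑? a
    ... | yes _ = zero
    ... | no  _ = suc zero

    faithful : ∀ {x y} → a ⊑ x → x ⊑ b → a ⊑ y → y ⊑ b → encode x ≡ encode y → x ⊑ y
    faithful {x} {y} _ x⊑b a⊑y y⊑b same with x ⊑? a | y ⊑? a | same
    ... | yes x⊑a | _       | _  = 𝔹.trans {x} {a} {y} x⊑a a⊑y
    ... | no  _   | no  y⋢a | _  = decidable-stable (x ⊑? y) λ x⋢y →
      cover y (a⊑y , y⊑b , y⋢a , λ b⊑y → x⋢y (𝔹.trans {x} {b} {y} x⊑b b⊑y))
    ... | no  _   | yes _   | ()

  -- Induction on the rank gap, which is strictly smaller on either side of an element strictly
  -- between; without such an element the interval has at most two elements.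
  coding : ∀ d {a b} → a ⊑ b → rk b ∸ rk a < d → Coding a b
  coding (suc d) {a} {b} a⊑b <d with any? (λ i → between? a b (enum i))
  ... | yes (i , a⊑c , c⊑b , c⋢a , b⋢c) = coding-split {a} {b} {enum i} a⊑c c⊑b
          (coding d {a} {enum i} a⊑c (<-≤-trans (∸-monoˡ-< c<b (<⇒≤ a<c)) (s≤s⁻¹ <d)))
          (coding d {enum i} {b} c⊑b (<-≤-trans (∸-monoʳ-< a<c (<⇒≤ c<b)) (s≤s⁻¹ <d)))
    where
    a<c : rk a < rk (enum i)
    a<c = rank-strict {π = proj₁ a} {proj₁ (enum i)} a⊑c c⋢a
    c<b : rk (enum i) < rk b
    c<b = rank-strict {π = proj₁ (enum i)} {proj₁ b} c⊑b b⋢c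
  ... | no ∄between with b ⊑? a
  ...   | yes b⊑a = coding-trivial {a} {b} b⊑a
  ...   | no  b⋢a = coding-cover {a} {b} a⊑b b⋢a λ c (a⊑c , c⊑b , c⋢a , b⋢c) →
    -- The search covered only enumerated elements; `c` is equal to one of them, to which its bounds
    -- transfer.
    let i , hits = Bijection.surjective size c
        eᵢ≈c = hits refl
        c≈eᵢ = 𝔹.Eq.sym {enum i} {c} eᵢ≈c
        eᵢ⊑c = 𝔹.reflexive {enum i} {c} eᵢ≈c
        c⊑eᵢ = 𝔹.reflexive {c} {enum i} c≈eᵢ
    in ∄between (i , 𝔹.trans {a} {c} {enum i} a⊑c c⊑eᵢ ,
                     𝔹.trans {enum i} {c} {b} eᵢ⊑c c⊑b ,
                     (λ eᵢ⊑a → c⋢a (𝔹.trans {c} {enum i} {a} c⊑eᵢ eᵢ⊑a)) ,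
                     (λ b⊑eᵢ → b⋢c (𝔹.trans {b} {enum i} {c} b⊑eᵢ eᵢ⊑c)))

  -- The whole lattice is the interval from `⊥` to `⊤`, whose rank gap is at most `m`.
  size≤2^m : k ≤ 2 ^ m
  size≤2^m = ≤-trans (injective⇒≤ λ {i} {j} → injective {i} {j}) (≤-trans codes≤
    (^-monoʳ-≤ 2 (≤-trans (m∸n≤m (rk 𝔹.⊤) (rk 𝔹.⊥)) (rank≤ (proj₁ 𝔹.⊤)))))
    where
    open Coding (coding (suc (rk 𝔹.⊤ ∸ rk 𝔹.⊥)) {𝔹.⊥} {𝔹.⊤} (𝔹.minimum 𝔹.⊤) (n<1+n _))

    ⊑-enum : ∀ {i j} → encode (enum i) ≡ encode (enum j) → enum i ⊑ enum j
    ⊑-enum {i} {j} = faithful {enum i} {enum j}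
      (𝔹.minimum (enum i)) (𝔹.maximum (enum i)) (𝔹.minimum (enum j)) (𝔹.maximum (enum j))

    injective : ∀ {i j} → encode (enum i) ≡ encode (enum j) → i ≡ j
    injective {i} {j} same = Bijection.injective size
      (𝔹.antisym {enum i} {enum j} (⊑-enum {i} {j} same) (⊑-enum {j} {i} (sym same)))

-- The sublattice of the spanning tree against the size bound

corollary4p5 : (n : ℕ) .{{_ : NonZero n}} (I : Family n) →
    IsSemiIntervalSystem I →
    IsBooleanLattice (subPoset (Part n) (𝓓 I)) →
    ∃[ B ] (IsBooleanSublattice (Part n) B
    × 𝓓 I ⊆ B
    × HasLargestSizeAmongBooleanSublattices (Part n) {0ℓ} B)
corollary4p5 zero {{0≢0}} = Empty.⊥-elim-irr (NonZero.nonZero 0≢0)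
corollary4p5 (suc m) I isSemiInterval boolean =
  Forest , isBooleanSublattice , (λ {π} → 𝓓⊆Forest {π}) ,
  2 ^ m , hasSize ,
  λ B′ k′ isBoolean size → SizeBound.size≤2^m (IsBooleanSublattice.isBooleanLattice isBoolean) size
  where
  open Growth isSemiInterval boolean
  open Tree spanningTree
  open RootedTree parent height (λ i → descends {i} ∈⊤)

  𝓓⊆Forest : 𝓓 I ⊆ Forest
  -- Each block of `π` is a set of `I`, hence connected in the spanning tree.
  𝓓⊆Forest {π} π∈𝓓 = linked⇒Forest π λ {x} {y} x∼y x≢y →
    [ (λ (i , x≡i , p∈) → inj₁ (i , x≡i , ∈block⇒∼ π p∈))
    , (λ (i , y≡i , p∈) → inj₂ (i , y≡i , trans (sym x∼y) (∈block⇒∼ π p∈)))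
    ]′ (linked (π∈𝓓 _ (block∈blocks π x)) (x∈block π x) (∼⇒∈block π x∼y) ∈⊤ ∈⊤ x≢y)
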